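{- Let $n\ge 1$. If $E\subseteq\mathbb{N}\times\mathbb{N}$ is a $\Sigma^0_{n+1}$ index equivalence relation, then $E$ is $\Pi^0_n$-graphable with diameter $2$.
   Context: $\varphi_e$ denotes the $e$-th partial computable function in a standard acceptable numbering. An equivalence relation $E$ on $\mathbb{N}$ is an index equivalence relation if whenever $\varphi_a=\varphi_{a'}$ and $\varphi_b=\varphi_{b'}$, we have $aEb\iff a'Eb'$. An equivalence relation $E$ on $X$ is $\Gamma$-graphable (for a pointclass $\Gamma$) if there is a simple undirected graph $G\subseteq X\times X$ in $\Gamma$ whose connectedness relation equals $E$; it is $\Gamma$-graphable with diameter $k$ if such a $G$ exists in which $k$ is the least integer such that any two $G$-connected points are joined by a path of length at most $k$. -}

module Defs where

open import Data.Fin using (Fin)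
open import Data.Nat using (ℕ; zero; suc; _≤_; _<_)
open import Data.Product using (∃; ∃-syntax; Σ-syntax; _×_)
open import Data.Sum using (_⊎_)
open import Data.Vec using (Vec; []; _∷_; lookup)
open import Function.Bundles using (_⇔_)
open import Level as Level using (Level; 0ℓ; Lift)
open import Relation.Binary using (Rel; IsEquivalence; Symmetric; Irreflexive)
open import Relation.Binary.Construct.Closure.ReflexiveTransitive using (Star; ε; _◅_)
open import Relation.Binary.PropositionalEquality using (_≡_)
open import Relation.Nullary using (¬_)
open import Relation.Unary using (Pred)

private
  1ℓ : Level
  1ℓ = Level.suc 0ℓ

-- Kleene's μ-recursive functions.
data Code : ℕ → Set where
  zeroᶜ : Code 0
  sucᶜ  : Code 1
  proj  : ∀ {k} → Fin k → Code k
  comp  : ∀ {k m} → Code m → Vec (Code k) m → Code k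
  prec  : ∀ {k} → Code k → Code (suc (suc k)) → Code (suc k)
  μ     : ∀ {k} → Code (suc k) → Code k

infix 4 _[_]⇓_

-- c [ xs ]⇓ y : the partial function coded by c is defined at xs with
-- value y.  It is undefined at xs when there is no such y.
data _[_]⇓_ : ∀ {k} → Code k → Vec ℕ k → ℕ → Set where
  zero⇓  : zeroᶜ [ [] ]⇓ 0
  suc⇓   : ∀ {x} → sucᶜ [ x ∷ [] ]⇓ suc x
  proj⇓  : ∀ {k} {i : Fin k} {xs} → proj i [ xs ]⇓ lookup xs i
  comp⇓  : ∀ {k m} {f : Code m} {gs : Vec (Code k) m} {xs ys z} →
           (∀ i → lookup gs i [ xs ]⇓ lookup ys i) →
           f [ ys ]⇓ z →
           comp f gs [ xs ]⇓ z
  precz⇓ : ∀ {k} {f : Code k} {g xs y} →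
           f [ xs ]⇓ y →
           prec f g [ 0 ∷ xs ]⇓ y
  precs⇓ : ∀ {k} {f : Code k} {g n xs r y} →
           prec f g [ n ∷ xs ]⇓ r →
           g [ r ∷ n ∷ xs ]⇓ y →
           prec f g [ suc n ∷ xs ]⇓ y
  μ⇓     : ∀ {k} {f : Code (suc k)} {xs y} →
           (∀ z → z < y → ∃[ v ] f [ z ∷ xs ]⇓ suc v) →
           f [ y ∷ xs ]⇓ 0 →
           μ f [ xs ]⇓ y

TotalComputable : (ℕ → ℕ) → Set
TotalComputable f = Σ[ c ∈ Code 1 ] (∀ x → c [ x ∷ [] ]⇓ f x)

-- Acceptable in the sense of Rogers.  φ e x y reads "φₑ(x) is defined and equals y".  By universality every
-- φₑ is a partial computable function; by smn (with c ignoring its first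
-- argument) every unary partial computable function is some φₑ.
record AcceptableNumbering : Set₁ where
  field
    φ         : ℕ → ℕ → ℕ → Set
    universal : Σ[ u ∈ Code 2 ]
                  (∀ e x y → φ e x y ⇔ u [ e ∷ x ∷ [] ]⇓ y)
    smn       : (c : Code 2) →
                Σ[ s ∈ (ℕ → ℕ) ]
                  TotalComputable s ×
                  (∀ e x y → φ (s e) x y ⇔ c [ e ∷ x ∷ [] ]⇓ y)

  infix 4 _≈φ_

  _≈φ_ : Rel ℕ 0ℓ
  a ≈φ b = ∀ x y → φ a x y ⇔ φ b x y

record IsIndexEquivalence (N : AcceptableNumbering) (E : Rel ℕ 0ℓ) : Set where
  open AcceptableNumbering N
  field
    isEquivalence : IsEquivalence E
    extensional   : ∀ {a a′ b b′} → a ≈φ a′ → b ≈φ b′ → E a b ⇔ E a′ b′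

Computable : ∀ {k} → Pred (Vec ℕ k) 0ℓ → Set
Computable {k} A =
  Σ[ c ∈ Code k ]
    (∀ xs → (A xs × c [ xs ]⇓ 1) ⊎ (¬ A xs × c [ xs ]⇓ 0))

mutual
  Σ⁰ : ℕ → ∀ {k} → Pred (Vec ℕ k) 0ℓ → Set₁
  Σ⁰ zero        A = Lift 1ℓ (Computable A)
  Σ⁰ (suc n) {k} A =
    Σ[ B ∈ Pred (Vec ℕ (suc k)) 0ℓ ]
      Π⁰ n B × (∀ xs → A xs ⇔ (∃[ y ] B (y ∷ xs)))

  Π⁰ : ℕ → ∀ {k} → Pred (Vec ℕ k) 0ℓ → Set₁
  Π⁰ zero        A = Lift 1ℓ (Computable A)
  Π⁰ (suc n) {k} A =
    Σ[ B ∈ Pred (Vec ℕ (suc k)) 0ℓ ]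
      Σ⁰ n B × (∀ xs → A xs ⇔ (∀ y → B (y ∷ xs)))

⟦_⟧ : Rel ℕ 0ℓ → Pred (Vec ℕ 2) 0ℓ
⟦ R ⟧ (x ∷ y ∷ []) = R x y

Σ⁰-Rel Π⁰-Rel : ℕ → Pred (Rel ℕ 0ℓ) 1ℓ
Σ⁰-Rel n R = Σ⁰ n ⟦ R ⟧
Π⁰-Rel n R = Π⁰ n ⟦ R ⟧

module _ {X : Set} where

  record IsSimpleGraph (G : Rel X 0ℓ) : Set where
    field
      symmetric   : Symmetric G
      irreflexive : Irreflexive _≡_ G

  -- Star G x y is the type of finite G-paths from x to y.
  pathLength : ∀ {G : Rel X 0ℓ} {x y} → Star G x y → ℕ
  pathLength ε       = 0
  pathLength (_ ◅ p) = suc (pathLength p)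

  DiameterAtMost : Rel X 0ℓ → ℕ → Set
  DiameterAtMost G k =
    ∀ x y → Star G x y → Σ[ p ∈ Star G x y ] pathLength p ≤ k

  HasDiameter : Rel X 0ℓ → ℕ → Set
  HasDiameter G k =
    DiameterAtMost G k × (∀ j → DiameterAtMost G j → k ≤ j)

  record IsGraphing (Γ : Pred (Rel X 0ℓ) 1ℓ) (E G : Rel X 0ℓ) : Set₁ where
    field
      isSimpleGraph : IsSimpleGraph G
      inΓ           : Γ G
      connectedness : ∀ x y → E x y ⇔ Star G x y

  Graphable : Pred (Rel X 0ℓ) 1ℓ → Rel X 0ℓ → Set₁
  Graphable Γ E = ∃[ G ] IsGraphing Γ E G

  GraphableWithDiameter : Pred (Rel X 0ℓ) 1ℓ → Rel X 0ℓ → ℕ → Set₁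
  GraphableWithDiameter Γ E k = ∃[ G ] (IsGraphing Γ E G × HasDiameter G k)

{-# OPTIONS --safe #-}
-- Acceptable numberings have an injective computable padding function `pad`,
-- so an index w of φₓ can carry a label recording y and a proof z that x E y.
-- Bounding the label by its value makes decoding w computable.  The graph joins
-- such a w, when the recorded z does witness x E y, to x and to y whenever these
-- lie below w.  An edge is then a decidable condition on its endpoints together with one
-- instance of the Π⁰ₙ matrix of E, and w is a common neighbour of x and y.  Two
-- different midpoints of the same pair are never adjacent.
module Submission where

open import Defs
open import Data.Fin using (Fin; zero; suc; toℕ; fromℕ<)
open import Data.Fin.Properties using (any?; injective⇒≤; toℕ-injective; toℕ<n; fromℕ<-injective)
open import Data.Nat using (ℕ; zero; suc; pred; _+_; _*_; _∸_; _⊔_; _⊓_; _≤_; _<_; z≤n; s≤s; _≟_; _≤?_)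
open import Data.Nat.Properties
open import Data.Product using (Σ-syntax; ∃-syntax; _×_; _,_; proj₁; proj₂)
open import Data.Sum as Sum using (_⊎_; inj₁; inj₂)
open import Data.Vec using (Vec; []; _∷_; head; tail; lookup; tabulate)
open import Data.Vec.Properties using (lookup∘tabulate)
open import Data.Vec.Relation.Binary.Pointwise.Extensional using (ext; Pointwise-≡⇒≡)
open import Function using (_∘_)
open import Function.Bundles using (_⇔_; mk⇔; module Equivalence)
open import Function.Construct.Composition using (_⇔-∘_)
open import Function.Construct.Identity using (⇔-id)
open import Function.Construct.Symmetry using (⇔-sym)
open import Level using (0ℓ; lift)
open import Relation.Binary using (Rel; IsEquivalence; tri<; tri≈; tri>)
open import Relation.Binary.Construct.Closure.ReflexiveTransitive using (Star; ε; _◅_; fold)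
open import Relation.Binary.PropositionalEquality hiding (isEquivalence)
open import Relation.Nullary using (¬_; yes; no; contradiction)
open import Relation.Unary using (Pred)

private
  variable
    k : ℕ

-- Evaluation of codes

⇓-deterministic : ∀ {c : Code k} {xs y y′} → c [ xs ]⇓ y → c [ xs ]⇓ y′ → y ≡ y′
⇓-deterministic zero⇓ zero⇓ = refl
⇓-deterministic suc⇓ suc⇓ = refl
⇓-deterministic proj⇓ proj⇓ = refl
⇓-deterministic (comp⇓ {ys = ys} gs f) (comp⇓ {ys = ys′} gs′ f′)
  with refl ← Pointwise-≡⇒≡ {xs = ys} {ys = ys′} (ext (λ i → ⇓-deterministic (gs i) (gs′ i)))
  = ⇓-deterministic f f′
⇓-deterministic (precz⇓ f) (precz⇓ f′) = ⇓-deterministic f f′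
⇓-deterministic (precs⇓ r g) (precs⇓ r′ g′)
  with refl ← ⇓-deterministic r r′ = ⇓-deterministic g g′
⇓-deterministic (μ⇓ {y = y} below at) (μ⇓ {y = y′} below′ at′) with <-cmp y y′
... | tri≈ _ y≡y′ _ = y≡y′
-- The search with the larger result must have seen a nonzero value at the smaller result, where the
-- other search stopped with 0.
... | tri< y<y′ _ _ with () ← ⇓-deterministic at (proj₂ (below′ y y<y′))
... | tri> _ _ y>y′ with () ← ⇓-deterministic (proj₂ (below y′ y>y′)) at′

-- Determinism forces the intermediate values hidden in `comp⇓` to be `ys`. Both directions matter
-- because the outer code may be partial: divergence has to be transported as well as values.
comp-⇓⇔ : ∀ {m} {f : Code m} {gs : Vec (Code k) m} {xs ys z} →
          (∀ i → lookup gs i [ xs ]⇓ lookup ys i) → comp f gs [ xs ]⇓ z ⇔ f [ ys ]⇓ z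
comp-⇓⇔ {f = f} {xs = xs} {ys} {z} gs⇓ = mk⇔ to (comp⇓ gs⇓)
  where
  to : comp f _ [ xs ]⇓ z → f [ ys ]⇓ z
  to (comp⇓ {ys = ys′} gs⇓′ f⇓)
    with refl ← Pointwise-≡⇒≡ {xs = ys′} {ys = ys} (ext (λ i → ⇓-deterministic (gs⇓′ i) (gs⇓ i))) = f⇓

private
  variable
    xs : Vec ℕ k
    x₀ x₁ x₂ x₃ : ℕ
    c₀ c₁ c₂ c₃ : Code k

args₁ : c₀ [ xs ]⇓ x₀ →
        ∀ i → lookup (c₀ ∷ []) i [ xs ]⇓ lookup (x₀ ∷ []) i
args₁ p zero = p

args₂ : c₀ [ xs ]⇓ x₀ → c₁ [ xs ]⇓ x₁ →
        ∀ i → lookup (c₀ ∷ c₁ ∷ []) i [ xs ]⇓ lookup (x₀ ∷ x₁ ∷ []) i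
args₂ p q zero    = p
args₂ p q (suc i) = args₁ q i

args₃ : c₀ [ xs ]⇓ x₀ → c₁ [ xs ]⇓ x₁ → c₂ [ xs ]⇓ x₂ →
        ∀ i → lookup (c₀ ∷ c₁ ∷ c₂ ∷ []) i [ xs ]⇓ lookup (x₀ ∷ x₁ ∷ x₂ ∷ []) i
args₃ p q r zero    = p
args₃ p q r (suc i) = args₂ q r i

args₄ : c₀ [ xs ]⇓ x₀ → c₁ [ xs ]⇓ x₁ → c₂ [ xs ]⇓ x₂ → c₃ [ xs ]⇓ x₃ →
        ∀ i → lookup (c₀ ∷ c₁ ∷ c₂ ∷ c₃ ∷ []) i [ xs ]⇓ lookup (x₀ ∷ x₁ ∷ x₂ ∷ x₃ ∷ []) i
args₄ p q r s zero    = p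
args₄ p q r s (suc i) = args₃ q r s i

-- Total computable functions

ComputableFun : (Vec ℕ k → ℕ) → Set
ComputableFun {k} f = Σ[ c ∈ Code k ] (∀ xs → c [ xs ]⇓ f xs)

Computable₂ : (ℕ → ℕ → ℕ) → Set
Computable₂ f = Σ[ c ∈ Code 2 ] (∀ x y → c [ x ∷ y ∷ [] ]⇓ f x y)

Computable₃ : (ℕ → ℕ → ℕ → ℕ) → Set
Computable₃ f = Σ[ c ∈ Code 3 ] (∀ x y z → c [ x ∷ y ∷ z ∷ [] ]⇓ f x y z)

private
  variable
    f g h : Vec ℕ k → ℕ

lambda₁ : ComputableFun f → TotalComputable (λ x → f (x ∷ []))
lambda₁ (c , c⇓) = c , λ x → c⇓ (x ∷ [])

lambda₂ : ComputableFun f → Computable₂ (λ x y → f (x ∷ y ∷ []))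
lambda₂ (c , c⇓) = c , λ x y → c⇓ (x ∷ y ∷ [])

var : (i : Fin k) → ComputableFun (λ xs → lookup xs i)
var i = proj i , λ _ → proj⇓

#0 : ComputableFun {suc k} (λ xs → lookup xs zero)
#0 = var zero

#1 : ComputableFun {suc (suc k)} (λ xs → lookup xs (suc zero))
#1 = var (suc zero)

#2 : ComputableFun {suc (suc (suc k))} (λ xs → lookup xs (suc (suc zero)))
#2 = var (suc (suc zero))

#3 : ComputableFun {suc (suc (suc (suc k)))} (λ xs → lookup xs (suc (suc (suc zero))))
#3 = var (suc (suc (suc zero)))

app₁ : ∀ {F} → TotalComputable F → ComputableFun f → ComputableFun (F ∘ f)
app₁ {f = f} (F , F⇓) (c , c⇓) = comp F (c ∷ []) , λ xs → comp⇓ (args₁ (c⇓ xs)) (F⇓ (f xs))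

app₂ : ∀ {F} → Computable₂ F → ComputableFun f → ComputableFun g →
       ComputableFun (λ xs → F (f xs) (g xs))
app₂ {f = f} {g} (F , F⇓) (c , c⇓) (d , d⇓) =
  comp F (c ∷ d ∷ []) , λ xs → comp⇓ (args₂ (c⇓ xs) (d⇓ xs)) (F⇓ (f xs) (g xs))

app₃ : ∀ {F} → Computable₃ F → ComputableFun f → ComputableFun g → ComputableFun h →
       ComputableFun (λ xs → F (f xs) (g xs) (h xs))
app₃ {f = f} {g} {h} (F , F⇓) (c , c⇓) (d , d⇓) (e , e⇓) =
  comp F (c ∷ d ∷ e ∷ []) ,
  λ xs → comp⇓ (args₃ (c⇓ xs) (d⇓ xs) (e⇓ xs)) (F⇓ (f xs) (g xs) (h xs))

weaken : ComputableFun f → ComputableFun (λ (xs : Vec ℕ (suc k)) → f (tail xs))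
weaken {k} {f} (c , c⇓) = comp c (tabulate (proj ∘ suc)) ,
  λ { (x ∷ xs) → comp⇓ (λ i → subst (_[ x ∷ xs ]⇓ lookup xs i) (sym (lookup∘tabulate (proj ∘ suc) i)) proj⇓) (c⇓ xs) }

primRec : (F : ℕ → Vec ℕ k → ℕ) → ComputableFun (F 0) → ComputableFun g →
          (∀ n xs → g (F n xs ∷ n ∷ xs) ≡ F (suc n) xs) →
          Σ[ c ∈ Code (suc k) ] (∀ n xs → c [ n ∷ xs ]⇓ F n xs)
primRec {k} F (c , c⇓) (d , d⇓) step = prec c d , prec⇓
  where
  prec⇓ : ∀ n xs → prec c d [ n ∷ xs ]⇓ F n xs
  prec⇓ zero    xs = precz⇓ (c⇓ xs)
  prec⇓ (suc n) xs =
    precs⇓ (prec⇓ n xs) (subst (d [ F n xs ∷ n ∷ xs ]⇓_) (step n xs) (d⇓ (F n xs ∷ n ∷ xs)))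

primRec₂ : (F : ℕ → ℕ → ℕ) → TotalComputable (F 0) → ComputableFun g →
           (∀ n x → g (F n x ∷ n ∷ x ∷ []) ≡ F (suc n) x) → Computable₂ F
primRec₂ F (c , c⇓) G step
  with d , d⇓ ← primRec (λ { n (x ∷ []) → F n x }) (c , λ { (x ∷ []) → c⇓ x }) G (λ { n (x ∷ []) → step n x })
  = d , λ n x → d⇓ n (x ∷ [])

suc-computable : TotalComputable suc
suc-computable = sucᶜ , λ _ → suc⇓

const-computable : ∀ n → ComputableFun {k} (λ _ → n)
const-computable zero    = comp zeroᶜ [] , λ _ → comp⇓ {ys = []} (λ ()) zero⇓
const-computable (suc n) = app₁ suc-computable (const-computable n)

pred-computable : TotalComputable pred
pred-computable
  with c , c⇓ ← primRec {g = λ xs → lookup xs (suc zero)} (λ { n [] → pred n }) (zeroᶜ , λ { [] → zero⇓ }) #1 (λ { n [] → refl })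
  = c , λ n → c⇓ n []

+-computable : Computable₂ _+_
+-computable = primRec₂ _+_ (lambda₁ #0) (app₁ suc-computable #0) (λ _ _ → refl)

*-computable : Computable₂ _*_
*-computable = primRec₂ _*_ (lambda₁ (const-computable 0)) (app₂ +-computable #2 #0) (λ _ _ → refl)

∸-computable : Computable₂ _∸_
∸-computable = lambda₂ (app₂ flipped #1 #0)
  where
  flipped : Computable₂ (λ n m → m ∸ n)
  flipped = primRec₂ (λ n m → m ∸ n) (lambda₁ #0) (app₁ pred-computable #0) (λ n m → pred[m∸n]≡m∸[1+n] m n)

⊔-computable : Computable₂ _⊔_
⊔-computable with c , c⇓ ← lambda₂ (app₂ +-computable #0 (app₂ ∸-computable #1 #0))
  = c , λ m n → subst (c [ m ∷ n ∷ [] ]⇓_) (m+[n∸m]≡m⊔n m n) (c⇓ m n)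
  where
  m+[n∸m]≡m⊔n : ∀ m n → m + (n ∸ m) ≡ m ⊔ n
  m+[n∸m]≡m⊔n zero    n       = refl
  m+[n∸m]≡m⊔n (suc m) zero    = cong suc (+-identityʳ m)
  m+[n∸m]≡m⊔n (suc m) (suc n) = cong suc (m+[n∸m]≡m⊔n m n)

⊓-computable : Computable₂ _⊓_
⊓-computable with c , c⇓ ← lambda₂ (app₂ ∸-computable #1 (app₂ ∸-computable #1 #0))
  = c , λ m n → subst (c [ m ∷ n ∷ [] ]⇓_) (n∸[n∸m]≡m⊓n m n) (c⇓ m n)
  where
  n∸[n∸m]≡m⊓n : ∀ m n → n ∸ (n ∸ m) ≡ m ⊓ n
  n∸[n∸m]≡m⊓n m n = trans (cong (_∸ (n ∸ m)) (sym (m⊓n+n∸m≡n m n))) (m+n∸n≡m (m ⊓ n) (n ∸ m))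

-- In what follows the value 0 stands for "true".

ifz : ℕ → ℕ → ℕ → ℕ
ifz zero    x y = x
ifz (suc _) x y = y

ifz-computable : Computable₃ ifz
ifz-computable
  with c , c⇓ ← primRec (λ { n (x ∷ y ∷ []) → ifz n x y }) (proj zero , λ { (x ∷ y ∷ []) → proj⇓ }) #3
                         (λ { n (x ∷ y ∷ []) → refl })
  = c , λ n x y → c⇓ n (x ∷ y ∷ [])

ifz-true : ∀ {n x y} → n ≡ 0 → ifz n x y ≡ x
ifz-true refl = refl

ifz-false : ∀ {n x y} → n ≢ 0 → ifz n x y ≡ y
ifz-false {zero}  n≢0 = contradiction refl n≢0
ifz-false {suc _} _   = refl

dist : ℕ → ℕ → ℕ
dist m n = (m ∸ n) + (n ∸ m)

dist≡0⇒≡ : ∀ {m n} → dist m n ≡ 0 → m ≡ n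
dist≡0⇒≡ {m} {n} eq = ≤-antisym (m∸n≡0⇒m≤n (m+n≡0⇒m≡0 (m ∸ n) eq)) (m∸n≡0⇒m≤n (m+n≡0⇒n≡0 (m ∸ n) eq))

≡⇒dist≡0 : ∀ {m n} → m ≡ n → dist m n ≡ 0
≡⇒dist≡0 {m} refl = cong₂ _+_ (n∸n≡0 m) (n∸n≡0 m)

dist-computable : Computable₂ dist
dist-computable = lambda₂ (app₂ +-computable (app₂ ∸-computable #0 #1) (app₂ ∸-computable #1 #0))

-- The value 0 also results when the search fails; f 0 is never tested.
searchBelow : (ℕ → ℕ) → ℕ → ℕ
searchBelow f zero    = 0
searchBelow f (suc n) = ifz (f (suc n)) (suc n) (searchBelow f n)

searchBelow-largest : ∀ (f : ℕ → ℕ) {m n} → m ≤ n → f m ≡ 0 →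
                      (∀ j → m < j → f j ≢ 0) → searchBelow f n ≡ m
-- Here `m` is 0, which is also the default value of the search, so the untested `f 0` does no harm.
searchBelow-largest f {n = zero} z≤n _ _ = refl
searchBelow-largest f {m} {suc n} m≤1+n fm≡0 above with m≤n⇒m<n∨m≡n m≤1+n
... | inj₂ refl            = ifz-true fm≡0
... | inj₁ m<1+n@(s≤s m≤n) = trans (ifz-false (above (suc n) m<1+n)) (searchBelow-largest f m≤n fm≡0 above)

searchBelow-computable : ∀ {F} → Computable₂ F → Computable₂ (λ n x → searchBelow (λ m → F m x) n)
searchBelow-computable {F} F-computable =
  primRec₂ (λ n x → searchBelow (λ m → F m x) n) (lambda₁ (const-computable 0))
    (app₃ ifz-computable (app₂ F-computable (app₁ suc-computable #1) #2) (app₁ suc-computable #1) #0)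
    (λ _ _ → refl)

-- The pair is read off from a ≤ a + b, which makes a + b the integer square root.
opaque
  pair : ℕ → ℕ → ℕ
  pair a b = (a + b) * (a + b) + a

  √ : ℕ → ℕ
  √ n = searchBelow (λ r → r * r ∸ n) n

  π₁ π₂ : ℕ → ℕ
  π₁ n = n ∸ √ n * √ n
  π₂ n = √ n ∸ π₁ n

  √-pair : ∀ a b → √ (pair a b) ≡ a + b
  √-pair a b = searchBelow-largest (λ r → r * r ∸ pair a b)
    (≤-trans (m≤m*m r) (m≤m+n (r * r) a)) (m≤n⇒m∸n≡0 (m≤m+n (r * r) a)) above
    where
    r : ℕ
    r = a + b

    m≤m*m : ∀ m → m ≤ m * m
    m≤m*m zero    = z≤n
    m≤m*m (suc m) = m≤m+n (suc m) _

    pair<[1+r]² : pair a b < suc r * suc r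
    pair<[1+r]² = s≤s (begin
      r * r + a     ≤⟨ +-monoʳ-≤ (r * r) (m≤m+n a b) ⟩
      r * r + r     ≡⟨ +-comm (r * r) r ⟩
      r + r * r     ≡⟨ sym (*-suc r r) ⟩
      r * suc r     ≤⟨ m≤n+m (r * suc r) r ⟩
      r + r * suc r ∎)
      where open ≤-Reasoning

    above : ∀ j → r < j → j * j ∸ pair a b ≢ 0
    above j r<j eq = <⇒≱ pair<[1+r]² (≤-trans (*-mono-≤ r<j r<j) (m∸n≡0⇒m≤n eq))

  π₁-pair : ∀ a b → π₁ (pair a b) ≡ a
  π₁-pair a b rewrite √-pair a b = m+n∸m≡n ((a + b) * (a + b)) a

  π₂-pair : ∀ a b → π₂ (pair a b) ≡ b
  π₂-pair a b rewrite π₁-pair a b | √-pair a b = m+n∸m≡n a b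

  pair-mono-≤ : ∀ {a a′ b b′} → a ≤ a′ → b ≤ b′ → pair a b ≤ pair a′ b′
  pair-mono-≤ a≤ b≤ = +-mono-≤ (*-mono-≤ (+-mono-≤ a≤ b≤) (+-mono-≤ a≤ b≤)) a≤

  pair-computable : Computable₂ pair
  pair-computable = lambda₂ (app₂ +-computable (app₂ *-computable (app₂ +-computable #0 #1) (app₂ +-computable #0 #1)) #0)

  √-computable : TotalComputable √
  √-computable = lambda₁ (app₂ (searchBelow-computable (lambda₂ (app₂ ∸-computable (app₂ *-computable #0 #0) #1))) #0 #0)

  π₁-computable : TotalComputable π₁
  π₁-computable = lambda₁ (app₂ ∸-computable #0 (app₂ *-computable (app₁ √-computable #0) (app₁ √-computable #0)))

  π₂-computable : TotalComputable π₂
  π₂-computable = lambda₁ (app₂ ∸-computable (app₁ √-computable #0) (app₁ π₁-computable #0))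

-- Padding

-- Only the first component of `t` determines the function computed by `pad t`, so the second is
-- free to carry a label.
record Padding (N : AcceptableNumbering) : Set where
  open AcceptableNumbering N
  field
    pad            : ℕ → ℕ
    pad-computable : TotalComputable pad
    pad-injective  : ∀ {t t′} → pad t ≡ pad t′ → t ≡ t′
    pad-≈φ         : ∀ t → pad t ≈φ π₁ t

  -- Pigeonhole: if all `suc b` candidates for `j` gave values below `b`, injectivity of `pad` would
  -- embed `Fin (suc b)` in `Fin b`. The bound on `j` keeps the label within reach of the search in
  -- `decode`.
  pad-unbounded : ∀ e i b → ∃[ j ] j ≤ b × b ≤ pad (pair e (pair i j))
  pad-unbounded e i b with any? {n = suc b} (λ j → b ≤? pad (pair e (pair i (toℕ j))))
  ... | yes (j , b≤) = toℕ j , ≤-pred (toℕ<n j) , b≤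
  ... | no  ∄j       = contradiction (injective⇒≤ small-injective) 1+n≰n
    where
    value : Fin (suc b) → ℕ
    value j = pad (pair e (pair i (toℕ j)))

    value<b : ∀ j → value j < b
    value<b j = ≰⇒> (λ b≤ → ∄j (j , b≤))

    small : Fin (suc b) → Fin b
    small j = fromℕ< (value<b j)

    small-injective : ∀ {j j′} → small j ≡ small j′ → j ≡ j′
    small-injective {j} {j′} eq = toℕ-injective (begin
      toℕ j                                     ≡⟨ sym (index≡ j) ⟩
      π₂ (π₂ (pair e (pair i (toℕ j))))         ≡⟨ cong (π₂ ∘ π₂) (pad-injective (fromℕ<-injective _ _ (value<b j) (value<b j′) eq)) ⟩
      π₂ (π₂ (pair e (pair i (toℕ j′))))        ≡⟨ index≡ j′ ⟩
      toℕ j′                                    ∎)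
      where
      open ≡-Reasoning
      index≡ : ∀ j → π₂ (π₂ (pair e (pair i (toℕ j)))) ≡ toℕ j
      index≡ j = trans (cong π₂ (π₂-pair e _)) (π₂-pair i _)

  -- The search range covers every triple whose entries are at most `w`. A failed search returns 0,
  -- so a result is trusted only after checking `pad (decode w) ≡ w`.
  decode : ℕ → ℕ
  decode w = searchBelow (λ t → dist (pad t) w) (pair w (pair w w))

  decode-computable : TotalComputable decode
  decode-computable =
    lambda₁ (app₂ (searchBelow-computable (lambda₂ (app₂ dist-computable (app₁ pad-computable #0) #1)))
                  (app₂ pair-computable #0 (app₂ pair-computable #0 #0)) #0)

  -- Monotonicity of `pair` puts the triple inside the search range, and injectivity of `pad`
  -- excludes any larger preimage of `w`.
  decode-pad : ∀ {e i j w} → pad (pair e (pair i j)) ≡ w → e ≤ w → i ≤ w → j ≤ w →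
               decode w ≡ pair e (pair i j)
  decode-pad {w = w} eq e≤w i≤w j≤w =
    searchBelow-largest (λ t → dist (pad t) w) (pair-mono-≤ e≤w (pair-mono-≤ i≤w j≤w)) (≡⇒dist≡0 eq)
      (λ t t> d≡0 → <⇒≢ t> (pad-injective (trans eq (sym (dist≡0⇒≡ d≡0)))))

-- By the recursion theorem there is a computable s with φ (s t) ⟨a,b⟩ = t when
-- a ≠ b and s a = s b, and φ (s t) x = φ (π₁ t) x otherwise.  A collision
-- s a = s b would give φ (s a) ⟨a,b⟩ = a and φ (s b) ⟨a,b⟩ = b, so s is injective
-- and the first case never occurs.
padding : (N : AcceptableNumbering) → Padding N
padding N = record
  { pad            = s
  ; pad-computable = lambda₁ (app₂ (lambda₂ (app₁ s₀-computable (app₂ pair-computable #0 #1))) (const-computable p) #0)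
  ; pad-injective  = s-injective
  ; pad-≈φ         = s-≈φ
  }
  where
  open AcceptableNumbering N

  u : Code 2
  u = proj₁ universal

  φ⇔u : ∀ e x y → φ e x y ⇔ u [ e ∷ x ∷ [] ]⇓ y
  φ⇔u = proj₂ universal

  -- Arguments: P = ⟨p,t⟩ and x = ⟨a,b⟩.
  pᶠ : ComputableFun (λ (v : Vec ℕ 2) → π₁ (lookup v zero))
  pᶠ = app₁ π₁-computable #0

  aᶠ : ComputableFun (λ (v : Vec ℕ 2) → π₁ (lookup v (suc zero)))
  aᶠ = app₁ π₁-computable #1

  bᶠ : ComputableFun (λ (v : Vec ℕ 2) → π₂ (lookup v (suc zero)))
  bᶠ = app₁ π₂-computable #1

  ⟨p,a⟩ᶠ : ComputableFun (λ (v : Vec ℕ 2) → pair (π₁ (lookup v zero)) (π₁ (lookup v (suc zero))))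
  ⟨p,a⟩ᶠ = app₂ pair-computable pᶠ aᶠ

  ⟨p,b⟩ᶠ : ComputableFun (λ (v : Vec ℕ 2) → pair (π₁ (lookup v zero)) (π₂ (lookup v (suc zero))))
  ⟨p,b⟩ᶠ = app₂ pair-computable pᶠ bᶠ

  -- The entries stand for s a, s b, a and b, so the value 0 reports a failure of injectivity.
  collision : Vec ℕ 4 → ℕ
  collision v = ifz (dist (lookup v (suc (suc zero))) (lookup v (suc (suc (suc zero))))) 1
                    (ifz (dist (lookup v zero) (lookup v (suc zero))) 0 1)

  collisionᶠ : ComputableFun collision
  collisionᶠ = app₃ ifz-computable (app₂ dist-computable #2 #3) (const-computable 1)
                 (app₃ ifz-computable (app₂ dist-computable #0 #1) (const-computable 0) (const-computable 1))

  -- Once `p` is an index of `s₀`, running `u` on `p` at ⟨p,a⟩ and ⟨p,b⟩ yields s a and s b. This is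
  -- the self-reference of the recursion theorem.
  test : Code 2
  test = comp (proj₁ collisionᶠ)
           (comp u (proj₁ pᶠ ∷ proj₁ ⟨p,a⟩ᶠ ∷ []) ∷ comp u (proj₁ pᶠ ∷ proj₁ ⟨p,b⟩ᶠ ∷ []) ∷
            proj₁ aᶠ ∷ proj₁ bᶠ ∷ [])

  tᶠ : ComputableFun (λ (v : Vec ℕ 2) → π₂ (lookup v zero))
  tᶠ = app₁ π₂-computable #0

  -- In the recursion step of `branch` the previous value and the counter precede P and x, so P is
  -- the third entry.
  eᶠ : ComputableFun (λ (v : Vec ℕ 4) → π₁ (π₂ (lookup v (suc (suc zero)))))
  eᶠ = app₁ π₁-computable (app₁ π₂-computable #2)

  -- Primitive recursion evaluates its base case first; as that is the total
  -- function t, the call to u is made only when the test fails.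
  branch : Code 3
  branch = prec (proj₁ tᶠ) (comp u (proj₁ eᶠ ∷ proj (suc (suc (suc zero))) ∷ []))

  c : Code 2
  c = comp branch (test ∷ proj zero ∷ proj (suc zero) ∷ [])

  s₀ : ℕ → ℕ
  s₀ = proj₁ (smn c)

  s₀-computable : TotalComputable s₀
  s₀-computable = proj₁ (proj₂ (smn c))

  s₀⇔ : ∀ e x y → φ (s₀ e) x y ⇔ c [ e ∷ x ∷ [] ]⇓ y
  s₀⇔ = proj₂ (proj₂ (smn c))

  s₀-ignoring : ComputableFun (λ (v : Vec ℕ 2) → s₀ (lookup v (suc zero)))
  s₀-ignoring = app₁ s₀-computable #1

  -- An index of `s₀`, obtained from a code that ignores its first argument; any value in place of 0
  -- would do. There is no circularity, since `s₀` is fixed before `p` is chosen.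
  p : ℕ
  p = proj₁ (smn (proj₁ s₀-ignoring)) 0

  u-p : ∀ x → u [ p ∷ x ∷ [] ]⇓ s₀ x
  u-p x = Equivalence.to (φ⇔u p x (s₀ x))
    (Equivalence.from (proj₂ (proj₂ (smn (proj₁ s₀-ignoring))) 0 x (s₀ x)) (proj₂ s₀-ignoring (0 ∷ x ∷ [])))

  s : ℕ → ℕ
  s t = s₀ (pair p t)

  call⇓ : ∀ {q : Vec ℕ 2 → ℕ} (qᶠ : ComputableFun (λ v → pair (π₁ (lookup v zero)) (q v))) t x →
          comp u (proj₁ pᶠ ∷ proj₁ qᶠ ∷ []) [ pair p t ∷ x ∷ [] ]⇓ s (q (pair p t ∷ x ∷ []))
  call⇓ {q} qᶠ t x = comp⇓
    (args₂ (subst (proj₁ pᶠ [ v ]⇓_) (π₁-pair p t) (proj₂ pᶠ v))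
           (subst (λ p′ → proj₁ qᶠ [ v ]⇓ pair p′ (q v)) (π₁-pair p t) (proj₂ qᶠ v)))
    (u-p (pair p (q v)))
    where v = pair p t ∷ x ∷ []

  test⇓ : ∀ t x → test [ pair p t ∷ x ∷ [] ]⇓ collision (s (π₁ x) ∷ s (π₂ x) ∷ π₁ x ∷ π₂ x ∷ [])
  test⇓ t x = comp⇓ {ys = s (π₁ x) ∷ s (π₂ x) ∷ π₁ x ∷ π₂ x ∷ []}
    (args₄ (call⇓ ⟨p,a⟩ᶠ t x) (call⇓ ⟨p,b⟩ᶠ t x) (proj₂ aᶠ _) (proj₂ bᶠ _))
    (proj₂ collisionᶠ _)

  c⇔branch : ∀ {t x y n} → collision (s (π₁ x) ∷ s (π₂ x) ∷ π₁ x ∷ π₂ x ∷ []) ≡ n →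
             c [ pair p t ∷ x ∷ [] ]⇓ y ⇔ branch [ n ∷ pair p t ∷ x ∷ [] ]⇓ y
  c⇔branch {t} {x} refl = comp-⇓⇔ (args₃ (test⇓ t x) proj⇓ proj⇓)

  branch-0 : ∀ t x → branch [ 0 ∷ pair p t ∷ x ∷ [] ]⇓ t
  branch-0 t x = precz⇓ (subst (proj₁ tᶠ [ pair p t ∷ x ∷ [] ]⇓_) (π₂-pair p t) (proj₂ tᶠ _))

  branch-1 : ∀ t x y → branch [ 1 ∷ pair p t ∷ x ∷ [] ]⇓ y ⇔ u [ π₁ t ∷ x ∷ [] ]⇓ y
  branch-1 t x y = mk⇔ (λ { (precs⇓ _ d) → Equivalence.to (comp-⇓⇔ args) d })
                       (λ d → precs⇓ (branch-0 t x) (Equivalence.from (comp-⇓⇔ args) d))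
    where
    args : ∀ {r n} i → lookup (proj₁ eᶠ ∷ proj (suc (suc (suc zero))) ∷ []) i [ r ∷ n ∷ pair p t ∷ x ∷ [] ]⇓
                       lookup (π₁ t ∷ x ∷ []) i
    args {r} {n} = args₂ (subst (proj₁ eᶠ [ r ∷ n ∷ pair p t ∷ x ∷ [] ]⇓_) (cong π₁ (π₂-pair p t)) (proj₂ eᶠ _)) proj⇓

  φ-deterministic : ∀ {e x y y′} → φ e x y → φ e x y′ → y ≡ y′
  φ-deterministic {e} {x} {y} {y′} d d′ =
    ⇓-deterministic (Equivalence.to (φ⇔u e x y) d) (Equivalence.to (φ⇔u e x y′) d′)

  s-injective : ∀ {a b} → s a ≡ s b → a ≡ b
  s-injective {a} {b} sa≡sb with a ≟ b
  ... | yes a≡b = a≡b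
  ... | no  a≢b = φ-deterministic (outputs a) (subst (λ e → φ e (pair a b) b) (sym sa≡sb) (outputs b))
    where
    collides : collision (s (π₁ (pair a b)) ∷ s (π₂ (pair a b)) ∷ π₁ (pair a b) ∷ π₂ (pair a b) ∷ []) ≡ 0
    collides = subst₂ (λ a′ b′ → collision (s a′ ∷ s b′ ∷ a′ ∷ b′ ∷ []) ≡ 0)
      (sym (π₁-pair a b)) (sym (π₂-pair a b))
      (trans (ifz-false (a≢b ∘ dist≡0⇒≡)) (ifz-true (≡⇒dist≡0 sa≡sb)))

    outputs : ∀ t → φ (s t) (pair a b) t
    outputs t = Equivalence.from (s₀⇔ _ _ _) (Equivalence.from (c⇔branch collides) (branch-0 t _))

  no-collision : ∀ a b → collision (s a ∷ s b ∷ a ∷ b ∷ []) ≡ 1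
  no-collision a b with a ≟ b
  ... | yes a≡b = ifz-true (≡⇒dist≡0 a≡b)
  ... | no  a≢b = trans (ifz-false (a≢b ∘ dist≡0⇒≡)) (ifz-false (a≢b ∘ s-injective ∘ dist≡0⇒≡))

  s-≈φ : ∀ t → s t ≈φ π₁ t
  s-≈φ t x y = ⇔-sym (φ⇔u (π₁ t) x y) ⇔-∘ (branch-1 t x y ⇔-∘ (c⇔branch (no-collision (π₁ x) (π₂ x)) ⇔-∘ s₀⇔ (pair p t) x y))

-- Arithmetical classes

ComputableMap : ∀ {m} → (Vec ℕ k → Vec ℕ m) → Set
ComputableMap F = ∀ i → ComputableFun (λ xs → lookup (F xs) i)

module _ {m} {A : Pred (Vec ℕ k) 0ℓ} {B : Pred (Vec ℕ m) 0ℓ} {χ : Vec ℕ k → ℕ} {F : Vec ℕ k → Vec ℕ m} where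

  Computable-restrict : ComputableFun χ → ComputableMap F →
                        (∀ xs → A xs ⇔ (χ xs ≡ 0 × B (F xs))) → Computable B → Computable A
  Computable-restrict (χᶜ , χ⇓) Fᶜ A⇔ (b , b-decides) =
    -- Truth is 0 for `χ` but 1 for the decision code `b`, and the default 0 rejects. Composition
    -- runs `b` even when `χ` fails, which is safe because `b` always halts.
    comp (proj₁ ifz-computable) (χᶜ ∷ comp b (tabulate (proj₁ ∘ Fᶜ)) ∷ proj₁ (const-computable 0) ∷ []) , decides
    where
    value⇓ : ∀ {v} xs → b [ F xs ]⇓ v →
             comp (proj₁ ifz-computable) (χᶜ ∷ comp b (tabulate (proj₁ ∘ Fᶜ)) ∷ proj₁ (const-computable 0) ∷ [])
               [ xs ]⇓ ifz (χ xs) v 0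
    value⇓ xs b⇓ = comp⇓
      (args₃ (χ⇓ xs)
             (comp⇓ (λ i → subst (_[ xs ]⇓ lookup (F xs) i) (sym (lookup∘tabulate (proj₁ ∘ Fᶜ) i)) (proj₂ (Fᶜ i) xs)) b⇓)
             (proj₂ (const-computable 0) xs))
      (proj₂ ifz-computable (χ xs) _ 0)

    decides : ∀ xs → (A xs × _ [ xs ]⇓ 1) ⊎ (¬ A xs × _ [ xs ]⇓ 0)
    decides xs with b-decides (F xs) | χ xs ≟ 0
    ... | inj₁ (BF , b⇓1)  | yes χ≡0 =
      inj₁ (Equivalence.from (A⇔ xs) (χ≡0 , BF) , subst (_ [ xs ]⇓_) (ifz-true χ≡0) (value⇓ xs b⇓1))
    ... | inj₂ (¬BF , b⇓0) | yes χ≡0 =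
      inj₂ (¬BF ∘ proj₂ ∘ Equivalence.to (A⇔ xs) , subst (_ [ xs ]⇓_) (ifz-true χ≡0) (value⇓ xs b⇓0))
    ... | inj₁ (_ , b⇓1)   | no χ≢0  =
      inj₂ (χ≢0 ∘ proj₁ ∘ Equivalence.to (A⇔ xs) , subst (_ [ xs ]⇓_) (ifz-false χ≢0) (value⇓ xs b⇓1))
    ... | inj₂ (_ , b⇓0)   | no χ≢0  =
      inj₂ (χ≢0 ∘ proj₁ ∘ Equivalence.to (A⇔ xs) , subst (_ [ xs ]⇓_) (ifz-false χ≢0) (value⇓ xs b⇓0))

private
  -- Under a quantifier the bound variable is passed on unchanged and `F` acts on the remaining
  -- arguments.
  lift-computable : ∀ {m} {F : Vec ℕ k → Vec ℕ m} → ComputableMap F →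
                    ComputableMap (λ xs → head xs ∷ F (tail xs))
  lift-computable Fᶜ zero    = proj zero , λ { (_ ∷ _) → proj⇓ }
  lift-computable Fᶜ (suc i) = weaken (Fᶜ i)

mutual
  -- The decidable conjunct moves inside the leading quantifier, and the same claim one level down
  -- applies to the matrix. Treating the conjunct and the substitution together lets a single
  -- induction carry both.
  Σ⁰-restrict : ∀ n {m} {A : Pred (Vec ℕ k) 0ℓ} {B : Pred (Vec ℕ m) 0ℓ}
                {χ : Vec ℕ k → ℕ} {F : Vec ℕ k → Vec ℕ m} →
                ComputableFun χ → ComputableMap F →
                (∀ xs → A xs ⇔ (χ xs ≡ 0 × B (F xs))) → Σ⁰ n B → Σ⁰ n A
  Σ⁰-restrict zero {F = F} χᶜ Fᶜ A⇔ (lift Bᶜ) = lift (Computable-restrict {F = F} χᶜ Fᶜ A⇔ Bᶜ)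
  Σ⁰-restrict (suc n) {χ = χ} {F} χᶜ Fᶜ A⇔ (C , ΠC , B⇔) =
    (λ xs → χ (tail xs) ≡ 0 × C (head xs ∷ F (tail xs))) ,
    Π⁰-restrict n {F = λ ys → head ys ∷ F (tail ys)} (weaken χᶜ) (lift-computable {F = F} Fᶜ) (λ _ → ⇔-id _) ΠC ,
    λ xs → mk⇔ (λ { (χ≡0 , y , Cy) → y , χ≡0 , Cy }) (λ { (y , χ≡0 , Cy) → χ≡0 , y , Cy })
           ⇔-∘ (mk⇔ (λ { (χ≡0 , b) → χ≡0 , Equivalence.to (B⇔ (F xs)) b })
                    (λ { (χ≡0 , b) → χ≡0 , Equivalence.from (B⇔ (F xs)) b }) ⇔-∘ A⇔ xs)

  Π⁰-restrict : ∀ n {m} {A : Pred (Vec ℕ k) 0ℓ} {B : Pred (Vec ℕ m) 0ℓ}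
                {χ : Vec ℕ k → ℕ} {F : Vec ℕ k → Vec ℕ m} →
                ComputableFun χ → ComputableMap F →
                (∀ xs → A xs ⇔ (χ xs ≡ 0 × B (F xs))) → Π⁰ n B → Π⁰ n A
  Π⁰-restrict zero {F = F} χᶜ Fᶜ A⇔ (lift Bᶜ) = lift (Computable-restrict {F = F} χᶜ Fᶜ A⇔ Bᶜ)
  Π⁰-restrict (suc n) {χ = χ} {F} χᶜ Fᶜ A⇔ (C , ΣC , B⇔) =
    (λ xs → χ (tail xs) ≡ 0 × C (head xs ∷ F (tail xs))) ,
    Σ⁰-restrict n {F = λ ys → head ys ∷ F (tail ys)} (weaken χᶜ) (lift-computable {F = F} Fᶜ) (λ _ → ⇔-id _) ΣC ,
    -- Recovering the side condition from the universal statement takes some instance; 0 serves.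
    λ xs → mk⇔ (λ { (χ≡0 , ∀C) y → χ≡0 , ∀C y }) (λ ∀χC → proj₁ (∀χC 0) , proj₂ ∘ ∀χC)
           ⇔-∘ (mk⇔ (λ { (χ≡0 , b) → χ≡0 , Equivalence.to (B⇔ (F xs)) b })
                    (λ { (χ≡0 , b) → χ≡0 , Equivalence.from (B⇔ (F xs)) b }) ⇔-∘ A⇔ xs)

-- The graph

module HubGraph {N : AcceptableNumbering} (P : Padding N) (B : Pred (Vec ℕ 3) 0ℓ) where

  open Padding P

  -- A label has the shape ⟨x,⟨⟨y,z⟩,j⟩⟩, where z witnesses x E y and j serves only to make the
  -- index large.
  source target witness : ℕ → ℕ
  source  w = π₁ (decode w)
  target  w = π₁ (π₁ (π₂ (decode w)))
  witness w = π₂ (π₁ (π₂ (decode w)))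

  claim : ℕ → Vec ℕ 3
  claim w = witness w ∷ source w ∷ target w ∷ []

  -- With 0 as truth, a sum is a conjunction and a product a disjunction; the first summand
  -- expresses `v < w`.
  spokeTest : ℕ → ℕ → ℕ
  spokeTest v w = (suc v ∸ w) + (dist (pad (decode w)) w + dist v (source w) * dist v (target w))

  record Spoke (v w : ℕ) : Set where
    field
      below      : v < w
      pad-decode : pad (decode w) ≡ w
      end        : v ≡ source w ⊎ v ≡ target w

  spokeTest-sound : ∀ {v w} → spokeTest v w ≡ 0 → Spoke v w
  spokeTest-sound {v} {w} eq = record
    { below      = m∸n≡0⇒m≤n (m+n≡0⇒m≡0 (suc v ∸ w) eq)
    ; pad-decode = dist≡0⇒≡ (m+n≡0⇒m≡0 (dist (pad (decode w)) w) eq′)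
    ; end        = Sum.map dist≡0⇒≡ dist≡0⇒≡
                     (m*n≡0⇒m≡0∨n≡0 (dist v (source w)) (m+n≡0⇒n≡0 (dist (pad (decode w)) w) eq′))
    }
    where eq′ = m+n≡0⇒n≡0 (suc v ∸ w) eq

  spokeTest-complete : ∀ {v w} → Spoke v w → spokeTest v w ≡ 0
  spokeTest-complete {v} {w} spoke =
    cong₂ _+_ (m≤n⇒m∸n≡0 below) (cong₂ _+_ (≡⇒dist≡0 pad-decode) (product≡0 end))
    where
    open Spoke spoke
    product≡0 : v ≡ source w ⊎ v ≡ target w → dist v (source w) * dist v (target w) ≡ 0
    product≡0 (inj₁ v≡) = cong (_* dist v (target w)) (≡⇒dist≡0 v≡)
    product≡0 (inj₂ v≡) = trans (cong (dist v (source w) *_) (≡⇒dist≡0 v≡)) (*-zeroʳ (dist v (source w)))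

  -- Taking the larger endpoint as the hub avoids a disjunction of two Π⁰ₙ statements,
  -- which need not be Π⁰ₙ constructively.
  record G (a b : ℕ) : Set where
    constructor edge
    field
      test≡0      : spokeTest (a ⊓ b) (a ⊔ b) ≡ 0
      claim-holds : B (claim (a ⊔ b))

  G-sym : ∀ {a b} → G a b → G b a
  G-sym {a} {b} (edge t c) =
    edge (subst₂ (λ v w → spokeTest v w ≡ 0) (⊓-comm a b) (⊔-comm a b) t) (subst (B ∘ claim) (⊔-comm a b) c)

  spoke⇒G : ∀ {v w} → Spoke v w → B (claim w) → G v w
  spoke⇒G {v} {w} spoke c = edge
    (subst₂ (λ v w → spokeTest v w ≡ 0) (sym (m≤n⇒m⊓n≡m v≤w)) (sym (m≤n⇒m⊔n≡n v≤w)) (spokeTest-complete spoke))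
    (subst (B ∘ claim) (sym (m≤n⇒m⊔n≡n v≤w)) c)
    where
    v≤w : v ≤ w
    v≤w = <⇒≤ (Spoke.below spoke)

  G⇒spoke : ∀ {a b} → G a b → a ≤ b → Spoke a b × B (claim b)
  G⇒spoke (edge t c) a≤b =
    spokeTest-sound (subst₂ (λ v w → spokeTest v w ≡ 0) (m≤n⇒m⊓n≡m a≤b) (m≤n⇒m⊔n≡n a≤b) t) ,
    subst (B ∘ claim) (m≤n⇒m⊔n≡n a≤b) c

  G-irrefl : ∀ {a b} → a ≡ b → ¬ G a b
  G-irrefl refl aa = <-irrefl refl (Spoke.below (proj₁ (G⇒spoke aa ≤-refl)))

  isSimpleGraph : IsSimpleGraph G
  isSimpleGraph = record { symmetric = G-sym ; irreflexive = G-irrefl }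

  G-Π⁰ : ∀ n → Π⁰ n B → Π⁰-Rel n G
  G-Π⁰ n = Π⁰-restrict n {F = claim ∘ hub} test-computable claim-computable
           (λ { (a ∷ b ∷ []) → mk⇔ (λ { (edge t c) → t , c }) (λ { (t , c) → edge t c }) })
    where
    hub : Vec ℕ 2 → ℕ
    hub xs = lookup xs zero ⊔ lookup xs (suc zero)

    hub-computable : ComputableFun hub
    hub-computable = app₂ ⊔-computable #0 #1

    decode-hub : ComputableFun (decode ∘ hub)
    decode-hub = app₁ decode-computable hub-computable

    claim-computable : ComputableMap (claim ∘ hub)
    claim-computable zero             = app₁ π₂-computable (app₁ π₁-computable (app₁ π₂-computable decode-hub))
    claim-computable (suc zero)       = app₁ π₁-computable decode-hub
    claim-computable (suc (suc zero)) = app₁ π₁-computable (app₁ π₁-computable (app₁ π₂-computable decode-hub))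

    end-computable : ComputableFun (λ xs → lookup xs zero ⊓ lookup xs (suc zero))
    end-computable = app₂ ⊓-computable #0 #1

    test-computable : ComputableFun (λ xs → spokeTest (lookup xs zero ⊓ lookup xs (suc zero)) (hub xs))
    test-computable =
      app₂ +-computable (app₂ ∸-computable (app₁ suc-computable end-computable) hub-computable)
        (app₂ +-computable (app₂ dist-computable (app₁ pad-computable decode-hub) hub-computable)
          (app₂ *-computable (app₂ dist-computable end-computable (claim-computable (suc zero)))
                             (app₂ dist-computable end-computable (claim-computable (suc (suc zero))))))

  -- Common neighbours

  record Midpoint (x y m : ℕ) : Set where
    field
      hub        : ℕ
      m<hub      : m < hub
      source≡    : source hub ≡ x
      target≡    : target hub ≡ y
      x-adjacent : G x hub
      y-adjacent : G y hub

  -- The free lower bound `m` allows hubs to be chosen above given vertices, which later yields two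
  -- distinct hubs over the same vertex.
  midpoint : ∀ {x y z} → B (z ∷ x ∷ y ∷ []) → ∀ m → Midpoint x y m
  midpoint {x} {y} {z} b m = record
    { hub        = w
    ; m<hub      = ≤-trans (s≤s (m≤m+n m _)) bound≤w
    ; source≡    = source≡
    ; target≡    = target≡
    ; x-adjacent = spoke⇒G (record { below = x<w ; pad-decode = cong pad decode≡ ; end = inj₁ (sym source≡) }) claim-holds
    ; y-adjacent = spoke⇒G (record { below = y<w ; pad-decode = cong pad decode≡ ; end = inj₂ (sym target≡) }) claim-holds
    }
    where
    i bound j w : ℕ
    i     = pair y z
    -- Lying above `m`, `x`, `y` and `i` at once makes the hub larger than both of its ends and
    -- keeps its label within the range searched by `decode`.
    bound = suc (m + (x + (y + i)))
    j     = proj₁ (pad-unbounded x i bound)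
    w     = pad (pair x (pair i j))

    bound≤w : bound ≤ w
    bound≤w = proj₂ (proj₂ (pad-unbounded x i bound))

    x<w : x < w
    x<w = ≤-trans (s≤s (≤-trans (m≤m+n x _) (m≤n+m _ m))) bound≤w

    y<w : y < w
    y<w = ≤-trans (s≤s (≤-trans (≤-trans (m≤m+n y _) (m≤n+m _ x)) (m≤n+m _ m))) bound≤w

    i<w : i < w
    i<w = ≤-trans (s≤s (≤-trans (≤-trans (m≤n+m i y) (m≤n+m _ x)) (m≤n+m _ m))) bound≤w

    decode≡ : decode w ≡ pair x (pair i j)
    decode≡ = decode-pad refl (<⇒≤ x<w) (<⇒≤ i<w) (≤-trans (proj₁ (proj₂ (pad-unbounded x i bound))) bound≤w)

    source≡ : source w ≡ x
    source≡ = trans (cong π₁ decode≡) (π₁-pair x _)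

    label≡ : π₁ (π₂ (decode w)) ≡ i
    label≡ = trans (cong (π₁ ∘ π₂) decode≡) (trans (cong π₁ (π₂-pair x _)) (π₁-pair i j))

    target≡ : target w ≡ y
    target≡ = trans (cong π₁ label≡) (π₁-pair y z)

    witness≡ : witness w ≡ z
    witness≡ = trans (cong π₂ label≡) (π₂-pair y z)

    claim-holds : B (claim w)
    claim-holds = subst B (sym (cong₂ _∷_ witness≡ (cong₂ _∷_ source≡ (cong (_∷ []) target≡)))) b

  -- A hub is an index of the same function as its source, so extensionality makes the two
  -- equivalent. For an edge to the target, the recorded witness adds that source and target are
  -- equivalent.
  G⇒E : ∀ {E} → IsIndexEquivalence N E → (∀ {x y z} → B (z ∷ x ∷ y ∷ []) → E x y) →
        ∀ {a b} → G a b → E a b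
  G⇒E {E} isIndex B⇒E {a} {b} ab = oriented (≤-total a b)
    where
    open AcceptableNumbering N using (_≈φ_)
    open IsIndexEquivalence isIndex
    open IsEquivalence isEquivalence renaming (refl to E-refl; sym to E-sym; trans to E-trans)

    source-E : ∀ {w} → pad (decode w) ≡ w → E (source w) w
    source-E {w} eq = Equivalence.from
      (extensional (λ _ _ → ⇔-id _) (subst (_≈φ source w) eq (pad-≈φ (decode w)))) E-refl

    spoke⇒E : ∀ {v w} → Spoke v w × B (claim w) → E v w
    spoke⇒E {v} {w} (spoke , b) = end-E (Spoke.end spoke)
      where
      end-E : v ≡ source w ⊎ v ≡ target w → E v w
      end-E (inj₁ refl) = source-E (Spoke.pad-decode spoke)
      end-E (inj₂ refl) = E-trans (E-sym (B⇒E b)) (source-E (Spoke.pad-decode spoke))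

    oriented : a ≤ b ⊎ b ≤ a → E a b
    oriented (inj₁ a≤b) = spoke⇒E (G⇒spoke ab a≤b)
    oriented (inj₂ b≤a) = E-sym (spoke⇒E (G⇒spoke (G-sym ab) b≤a))

  -- The lower bound on the diameter

  nonadjacent⇒2≤ : ∀ {x y} (p : Star G x y) → x ≢ y → ¬ G x y → 2 ≤ pathLength p
  nonadjacent⇒2≤ ε           x≢y _   = contradiction refl x≢y
  nonadjacent⇒2≤ (xy ◅ ε)    _   ¬xy = contradiction xy ¬xy
  nonadjacent⇒2≤ (_ ◅ _ ◅ _) _   _   = s≤s (s≤s z≤n)

  -- In such an edge the second hub is the larger endpoint, so the first would have to be its source
  -- or target. Both of these are `x`, whereas the first hub lies strictly above `x`.
  midpoints-nonadjacent : ∀ {x} (M : Midpoint x x x) (M′ : Midpoint x x (Midpoint.hub M)) →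
                          ¬ G (Midpoint.hub M) (Midpoint.hub M′)
  midpoints-nonadjacent M M′ e with Spoke.end (proj₁ (G⇒spoke e (<⇒≤ (Midpoint.m<hub M′))))
  ... | inj₁ eq = <⇒≢ (Midpoint.m<hub M) (sym (trans eq (Midpoint.source≡ M′)))
  ... | inj₂ eq = <⇒≢ (Midpoint.m<hub M) (sym (trans eq (Midpoint.target≡ M′)))

  -- The two hubs are connected through `x`, yet they are distinct and not adjacent, so no path
  -- between them is shorter than 2.
  midpoints⇒diameter≥2 : ∀ {x} (M : Midpoint x x x) → Midpoint x x (Midpoint.hub M) →
                         ∀ j → DiameterAtMost G j → 2 ≤ j
  midpoints⇒diameter≥2 M M′ j diam
    with p , p≤j ← diam _ _ (G-sym (Midpoint.x-adjacent M) ◅ Midpoint.x-adjacent M′ ◅ ε)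
    = ≤-trans (nonadjacent⇒2≤ p (<⇒≢ (Midpoint.m<hub M′)) (midpoints-nonadjacent M M′)) p≤j

  diameter≥2 : ∀ {x z} → B (z ∷ x ∷ x ∷ []) → ∀ j → DiameterAtMost G j → 2 ≤ j
  diameter≥2 {x} b = midpoints⇒diameter≥2 (midpoint b x) (midpoint b _)

-- The graphing of diameter two

Padding⇒graphable : ∀ {N} → Padding N → ∀ n (E : Rel ℕ 0ℓ) → IsIndexEquivalence N E →
                    Σ⁰-Rel (suc n) E → GraphableWithDiameter (Π⁰-Rel n) E 2
Padding⇒graphable {N} P n E isIndex (B , ΠB , E⇔) =
  -- The lower bound starts from one true instance of the matrix, supplied by reflexivity at 0.
  G , graphing , (λ x y → join ∘ Star⇒E) , diameter≥2 (proj₂ (witnessed {0} E-refl))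
  where
  open HubGraph P B
  open IsEquivalence (IsIndexEquivalence.isEquivalence isIndex) renaming (refl to E-refl; trans to E-trans)

  witnessed : ∀ {x y} → E x y → ∃[ z ] B (z ∷ x ∷ y ∷ [])
  witnessed {x} {y} = Equivalence.to (E⇔ (x ∷ y ∷ []))

  Star⇒E : ∀ {x y} → Star G x y → E x y
  Star⇒E = fold E (λ xy → E-trans (G⇒E isIndex (λ b → Equivalence.from (E⇔ _) (_ , b)) xy)) E-refl

  join : ∀ {x y} → E x y → Σ[ p ∈ Star G x y ] pathLength p ≤ 2
  -- The route through a hub is uniform: it also serves when `x` and `y` coincide, as a walk to the
  -- hub and back.
  join exy = (x-adjacent ◅ G-sym y-adjacent ◅ ε) , ≤-refl
    where open Midpoint (midpoint (proj₂ (witnessed exy)) 0)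

  graphing : IsGraphing (Π⁰-Rel n) E G
  graphing = record
    { isSimpleGraph = isSimpleGraph
    ; inΓ           = G-Π⁰ n ΠB
    ; connectedness = λ x y → mk⇔ (proj₁ ∘ join) Star⇒E
    }

theorem5p1 : (N : AcceptableNumbering) (n : ℕ) → 1 ≤ n →
    (E : Rel ℕ 0ℓ) → IsIndexEquivalence N E → Σ⁰-Rel (suc n) E →
    GraphableWithDiameter (Π⁰-Rel n) E 2
theorem5p1 N n _ = Padding⇒graphable (padding N) n
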